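{- The formula $\mathrm{Rec}^{\aleph_0} P\rightarrow\mathrm{Rec} P$ is not uniformly valid.
   Context: Setting: Japaridze's computability logic. $P$ is an atom and $F\rightarrow G:=\neg F\vee G$. $\mathrm{Rec}A$ is the uncountable branching recurrence. Its legal runs consist of moves $w.\alpha$ ($w$ a finite bitstring) such that every thread $\Gamma^{\preceq x}$ ($x$ an infinite bitstring) is legal in $A$, and $\top$ wins iff it wins $A$ in every thread $x$. $\mathrm{Rec}^{\aleph_0}A$ is the countable branching recurrence: same legal runs, but $\top$ wins iff it wins $A$ in every thread indexed by an infinite bitstring with finitely many 1s. The duals are $\mathrm{Corec}A=\neg\mathrm{Rec}\neg A$ and $\mathrm{Corec}^{\aleph_0}A=\neg\mathrm{Rec}^{\aleph_0}\neg A$. A formula is uniformly valid iff one machine wins it under every interpretation of atoms as static games. -}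

module Defs where

open import Data.Nat using (ℕ; zero; suc; _≤_; _<_; _≡ᵇ_)
open import Data.Bool using (Bool; true; false; T; _∧_; _∨_; if_then_else_; not)
open import Data.List using (List; []; _∷_; _++_; map; length; filter; mapMaybe; concatMap)
open import Data.List.Relation.Unary.All using (All)
open import Data.Maybe using (Maybe; just; nothing; is-just)
open import Data.Product using (Σ; ∃; _×_; _,_; proj₁; proj₂)
open import Data.Sum using (_⊎_; inj₁; inj₂)
open import Data.Fin using (Fin)
open import Relation.Nullary using (¬_)
open import Relation.Binary.PropositionalEquality using (_≡_)

data Sym : Set where
  s0 s1 sdot : Sym

Move : Set
Move = List Sym

data Player : Set where
  ⊤ₚ ⊥ₚ : Player

eqP : Player → Player → Bool
eqP ⊤ₚ ⊤ₚ = true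
eqP ⊥ₚ ⊥ₚ = true
eqP _  _  = false

opp : Player → Player
opp ⊤ₚ = ⊥ₚ
opp ⊥ₚ = ⊤ₚ

LabMove : Set
LabMove = Player × Move

Position : Set
Position = List LabMove

-- A (finite or infinite) run, presented as a sequence of finite chunks:
-- the run is the concatenation  r 0 ++ r 1 ++ r 2 ++ ...
-- (finite iff all but finitely many chunks are empty).
Run : Set
Run = ℕ → List LabMove

upto : Run → ℕ → Position
upto r zero    = []
upto r (suc n) = upto r n ++ r n

_⊑_ : Position → Position → Set
Φ ⊑ Ψ = ∃ λ Θ → Φ ++ Θ ≡ Ψ

-- two presentations of the same run (same sequence of labelled moves)
_≈r_ : Run → Run → Set
r ≈r r' = (∀ n → ∃ λ m → upto r n ⊑ upto r' m) × (∀ n → ∃ λ m → upto r' n ⊑ upto r m)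

_⊑r_ : Position → Run → Set
Φ ⊑r r = ∃ λ n → Φ ⊑ upto r n

mapRun : (Position → Position) → Run → Run
mapRun f r n = f (r n)

record Game : Set₁ where
  field
    Lr  : Position → Set   -- legal (finite) positions
    Win : Run → Set        -- ⊤ wins the (legal) run

open Game public

LegalRun : Game → Run → Set
LegalRun G r = ∀ n → Lr G (upto r n)

FaultBy : Player → Game → Run → Set
FaultBy p G r = ∃ λ Φ → ∃ λ α →
  Lr G Φ × ¬ Lr G (Φ ++ (p , α) ∷ []) × ((Φ ++ (p , α) ∷ []) ⊑r r)

Wins⊤ : Game → Run → Set
Wins⊤ G r = (LegalRun G r × Win G r) ⊎ FaultBy ⊥ₚ G r

WinsBy : Player → Game → Run → Set
WinsBy ⊤ₚ G r = Wins⊤ G r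
WinsBy ⊥ₚ G r = ¬ Wins⊤ G r

record IsGame (G : Game) : Set where
  field
    empty-legal  : Lr G []
    prefix-closed : ∀ Φ Ψ → Lr G (Φ ++ Ψ) → Lr G Φ
    win-respects : ∀ r r' → r ≈r r' → Win G r → Win G r'

onlyBy : Player → Run → Run
onlyBy p = mapRun (filter (λ m → eqP (proj₁ m) p Data.Bool.≟ true))
  where import Data.Bool

count : Player → Position → ℕ
count p Φ = length (filter (λ m → eqP (proj₁ m) p Data.Bool.≟ true) Φ)
  where import Data.Bool

-- in r, the k-th (opp p)-labelled move is made before the n-th p-labelled move
-- (or the latter does not exist)
Before : Player → ℕ → ℕ → Run → Set
Before p k n r = ∃ λ Φ → Φ ⊑r r × k ≤ count (opp p) Φ × count p Φ < n

Delay : Player → Run → Run → Set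
Delay p Γ Δ =
  (onlyBy ⊤ₚ Γ ≈r onlyBy ⊤ₚ Δ) × (onlyBy ⊥ₚ Γ ≈r onlyBy ⊥ₚ Δ) ×
  (∀ k n → 1 ≤ k → 1 ≤ n → Before p k n Γ → Before p k n Δ)

Static : Game → Set
Static G = ∀ p Γ Δ → Delay p Γ Δ → WinsBy p G Γ → WinsBy p G Δ

flipM : LabMove → LabMove
flipM (p , α) = (opp p , α)

flipPos : Position → Position
flipPos = map flipM

¬ᵍ : Game → Game
Lr  (¬ᵍ A) Φ = Lr A (flipPos Φ)
Win (¬ᵍ A) r = ¬ Win A (mapRun flipPos r)

-- component b of a disjunction: moves "0.β" (b = false) and "1.β" (b = true)
comp : Bool → LabMove → Maybe LabMove
comp false (p , s0 ∷ sdot ∷ β) = just (p , β)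
comp true  (p , s1 ∷ sdot ∷ β) = just (p , β)
comp _     _                   = nothing

proj∨ : Bool → Position → Position
proj∨ b = mapMaybe (comp b)

_∨ᵍ_ : Game → Game → Game
Lr  (A ∨ᵍ B) Φ = All (λ m → T (is-just (comp false m) ∨ is-just (comp true m))) Φ
                 × Lr A (proj∨ false Φ) × Lr B (proj∨ true Φ)
Win (A ∨ᵍ B) r = Win A (mapRun (proj∨ false) r) ⊎ Win B (mapRun (proj∨ true) r)

_⇒ᵍ_ : Game → Game → Game
A ⇒ᵍ B = ¬ᵍ A ∨ᵍ B

Bits : Set
Bits = ℕ → Bool

-- parse a move "w.α" with w a finite bitstring
addr : Move → Maybe (List Bool × Move)
addr []           = nothing
addr (sdot ∷ α)   = just ([] , α)
addr (s0 ∷ α) with addr α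
... | just (w , β) = just (false ∷ w , β)
... | nothing      = nothing
addr (s1 ∷ α) with addr α
... | just (w , β) = just (true ∷ w , β)
... | nothing      = nothing

beq : Bool → Bool → Bool
beq true  true  = true
beq false false = true
beq _     _     = false

prefixOf : List Bool → Bits → Bool
prefixOf []      x = true
prefixOf (b ∷ w) x = beq b (x 0) ∧ prefixOf w (λ n → x (suc n))

thr1 : Bits → LabMove → Maybe LabMove
thr1 x (p , μ) with addr μ
... | just (w , α) = if prefixOf w x then just (p , α) else nothing
... | nothing      = nothing

thread : Bits → Position → Position
thread x = mapMaybe (thr1 x)

FinitelyManyOnes : Bits → Set
FinitelyManyOnes x = ∃ λ N → ∀ n → N ≤ n → x n ≡ false

recLr : Game → Position → Set
recLr A Φ = All (λ m → T (is-just (addr (proj₂ m)))) Φ × (∀ (x : Bits) → Lr A (thread x Φ))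

Rec : Game → Game
Lr  (Rec A) = recLr A
Win (Rec A) r = ∀ (x : Bits) → Win A (mapRun (thread x) r)

Rec0 : Game → Game
Lr  (Rec0 A) = recLr A
Win (Rec0 A) r = ∀ (x : Bits) → FinitelyManyOnes x → Win A (mapRun (thread x) r)

-- run-tape symbols: blank, a label, or a move symbol
RSym : Set
RSym = Maybe (Player ⊎ Sym)

data Dir : Set where
  left right stay : Dir

record HPM : Set where
  field
    nQ nW : ℕ
    -- states Fin (suc nQ), start state zero; work alphabet Fin (suc nW), blank zero
    moveState : Fin (suc nQ)
    -- (state, scanned work symbol, scanned run-tape symbol) ↦
    -- (new state, written work symbol, work head move, run head move, symbol appended to buffer)
    δ : Fin (suc nQ) → Fin (suc nW) → RSym →
        Fin (suc nQ) × Fin (suc nW) × Dir × Dir × Maybe Sym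

record Config (M : HPM) : Set where
  field
    state : Fin (suc (HPM.nQ M))
    work  : ℕ → Fin (suc (HPM.nW M))
    whead : ℕ
    rhead : ℕ
    buf   : List Sym
    pos   : Position

encode : Position → List (Player ⊎ Sym)
encode = concatMap (λ m → inj₁ (proj₁ m) ∷ map inj₂ (proj₂ m))

cell : List (Player ⊎ Sym) → ℕ → RSym
cell []       _       = nothing
cell (a ∷ _)  zero    = just a
cell (_ ∷ as) (suc i) = cell as i

moveHead : Dir → ℕ → ℕ
moveHead left  zero    = zero
moveHead left  (suc i) = i
moveHead right i       = suc i
moveHead stay  i       = i

eqFin : ∀ {n} → Fin n → Fin n → Bool
eqFin a b = Data.Fin.toℕ a ≡ᵇ Data.Fin.toℕ b

initConfig : (M : HPM) → Config M
initConfig M = record { state = Data.Fin.zero ; work = λ _ → Data.Fin.zero ; whead = 0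
                      ; rhead = 0 ; buf = [] ; pos = [] }

topMove : (M : HPM) → Config M → List LabMove
topMove M C = if eqFin (Config.state C) (HPM.moveState M) then (⊤ₚ , Config.buf C) ∷ [] else []

added : (M : HPM) → Config M → List Move → List LabMove
added M C E = topMove M C ++ map (λ α → (⊥ₚ , α)) E

step : (M : HPM) → Config M → List Move → Config M
step M C E with HPM.δ M (Config.state C) (Config.work C (Config.whead C))
                        (cell (encode (Config.pos C)) (Config.rhead C))
... | (q' , a , dw , dr , b) = record
  { state = q'
  ; work  = λ j → if j ≡ᵇ Config.whead C then a else Config.work C j
  ; whead = moveHead dw (Config.whead C)
  ; rhead = moveHead dr (Config.rhead C)
  ; buf   = (if eqFin (Config.state C) (HPM.moveState M) then [] else Config.buf C)
            ++ (Data.Maybe.maybe (λ s → s ∷ []) [] b)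
  ; pos   = Config.pos C ++ added M C E }

-- environment behaviour: the ⊥-moves it makes at each clock cycle
Env : Set
Env = ℕ → List Move

config : (M : HPM) → Env → ℕ → Config M
config M e zero    = initConfig M
config M e (suc t) = step M (config M e t) (e t)

runOf : (M : HPM) → Env → Run
runOf M e t = added M (config M e t) (e t)

_⊨_ : HPM → Game → Set
M ⊨ G = ∀ (e : Env) → Wins⊤ G (runOf M e)

module Submission where

-- Let the environment, at step t, make in the consequent the move w.w in every
-- thread w of length t+1, so that ⊥'s moves in consequent thread y spell out y.
-- Let P be the static game that ⊤ wins iff ⊥'s moves copy ⊤'s antecedent moves
-- in some thread whose address has finitely many 1s.  Each such thread of
-- Rec⁰ P copies itself, so the machine loses the antecedent and must win Rec P:
-- then every y is recovered from the finite bitstring w whose antecedent thread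
-- consequent thread y copies, and y ↦ w is an injection of Cantor space into a
-- countable set.  The diagonal argument refuting this needs one instance of
-- excluded middle, which the machine itself supplies: with Win = const Z it
-- decides Z.

open import Defs
open import Data.Product using (Σ)
open import Relation.Nullary using (¬_)

open import Data.Bool using (Bool; true; false; not; _∧_; T; if_then_else_; _≟_)
open import Data.Bool.Properties using (not-¬)
open import Data.Empty using (⊥; ⊥-elim)
open import Data.List using (List; []; _∷_; _++_; [_]; map; mapMaybe; filter; applyUpTo)
open import Data.List.Properties
  using (++-assoc; ++-identityʳ; ∷-injectiveˡ; ∷-injectiveʳ; map-injective; mapMaybe-++; mapMaybe-map;
         mapMaybe-nothing; mapMaybe-cong; filter-++; filter-none; applyUpTo-∷ʳ)
open import Data.List.Relation.Unary.All using (All; []; _∷_)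
import Data.List.Relation.Unary.All as All
import Data.List.Relation.Unary.All.Properties as AllP
open import Data.Maybe using (Maybe; just; nothing; is-just)
open import Data.Nat using (ℕ; zero; suc; _≤_; _<_; z≤n; s≤s)
open import Data.Nat.Binary as ℕᵇ using (ℕᵇ; 2[1+_]; 1+[2_])
import Data.Nat.Binary.Properties as ℕᵇ
open import Data.Nat.Properties using (≤-refl)
open import Data.Product using (∃; _,_; proj₁; proj₂)
open import Data.Sum using (inj₁; inj₂; [_,_]′)
open import Data.Unit using (⊤; tt)
open import Function using (_∘_; const)
open import Relation.Nullary using (Dec; yes; no)
open import Relation.Binary.PropositionalEquality hiding ([_])

⊑-trans : ∀ {Φ Ψ Ξ} → Φ ⊑ Ψ → Ψ ⊑ Ξ → Φ ⊑ Ξ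
⊑-trans {Φ} (Θ , refl) (Θ′ , refl) = Θ ++ Θ′ , sym (++-assoc Φ Θ Θ′)

⊑-reflexive : ∀ {Φ Ψ} → Φ ≡ Ψ → Φ ⊑ Ψ
⊑-reflexive {Φ} refl = [] , ++-identityʳ Φ

infix 4 _≲r_

_≲r_ : Run → Run → Set
r ≲r r′ = ∀ n → ∃ λ m → upto r n ⊑ upto r′ m

≲r-trans : ∀ {r₁ r₂ r₃} → r₁ ≲r r₂ → r₂ ≲r r₃ → r₁ ≲r r₃
≲r-trans r₁≲r₂ r₂≲r₃ n with r₁≲r₂ n
... | m , le with r₂≲r₃ m
...   | k , le′ = k , ⊑-trans le le′

≈r-sym : ∀ {r r′} → r ≈r r′ → r′ ≈r r
≈r-sym (r≲r′ , r′≲r) = r′≲r , r≲r′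

≈r-trans : ∀ {r₁ r₂ r₃} → r₁ ≈r r₂ → r₂ ≈r r₃ → r₁ ≈r r₃
≈r-trans (a , b) (c , d) = ≲r-trans a c , ≲r-trans d b

upto-cong : ∀ {r r′ : Run} → r ≗ r′ → upto r ≗ upto r′
upto-cong r≗r′ zero    = refl
upto-cong r≗r′ (suc n) = cong₂ _++_ (upto-cong r≗r′ n) (r≗r′ n)

≗⇒≈r : ∀ {r r′ : Run} → r ≗ r′ → r ≈r r′
≗⇒≈r r≗r′ = (λ n → n , ⊑-reflexive (upto-cong r≗r′ n))
          , (λ n → n , ⊑-reflexive (sym (upto-cong r≗r′ n)))

movesBy : Player → Position → Position
movesBy p = filter (λ m → eqP (proj₁ m) p ≟ true)

upto-onlyBy : ∀ p r n → upto (onlyBy p r) n ≡ movesBy p (upto r n)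
upto-onlyBy p r zero    = refl
upto-onlyBy p r (suc n) = trans (cong (_++ movesBy p (r n)) (upto-onlyBy p r n))
                                (sym (filter-++ _ (upto r n) (r n)))

⊑-movesBy : ∀ p {Φ Ψ} → Φ ⊑ Ψ → movesBy p Φ ⊑ movesBy p Ψ
⊑-movesBy p {Φ} (Θ , refl) = movesBy p Θ , sym (filter-++ _ Φ Θ)

≲r-onlyBy : ∀ p {r r′} → r ≲r r′ → onlyBy p r ≲r onlyBy p r′
≲r-onlyBy p {r} {r′} r≲r′ n with r≲r′ n
... | m , le = m , subst₂ _⊑_ (sym (upto-onlyBy p r n)) (sym (upto-onlyBy p r′ m)) (⊑-movesBy p le)

onlyBy-cong : ∀ p {r r′} → r ≈r r′ → onlyBy p r ≈r onlyBy p r′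
onlyBy-cong p (r≲r′ , r′≲r) = ≲r-onlyBy p r≲r′ , ≲r-onlyBy p r′≲r

unrestricted : (Run → Set) → Game
unrestricted W = record { Lr = λ _ → ⊤ ; Win = W }

DependsOnlyOn⊥ : (Run → Set) → Set
DependsOnlyOn⊥ W = ∀ r r′ → onlyBy ⊥ₚ r ≈r onlyBy ⊥ₚ r′ → W r → W r′

unrestricted-isGame : ∀ W → DependsOnlyOn⊥ W → IsGame (unrestricted W)
unrestricted-isGame W dep = record
  { empty-legal   = tt
  ; prefix-closed = λ _ _ _ → tt
  ; win-respects  = λ r r′ r≈r′ → dep r r′ (onlyBy-cong ⊥ₚ r≈r′)
  }

unrestricted-noFault : ∀ W p r → ¬ FaultBy p (unrestricted W) r
unrestricted-noFault W p r (_ , _ , _ , illegal , _) = illegal tt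

-- A delay leaves ⊥'s moves unchanged up to re-chunking.
unrestricted-static : ∀ W → DependsOnlyOn⊥ W → Static (unrestricted W)
unrestricted-static W dep ⊤ₚ Γ Δ (_ , same⊥ , _) (inj₁ (_ , won)) = inj₁ ((λ _ → tt) , dep Γ Δ same⊥ won)
unrestricted-static W dep ⊤ₚ Γ Δ _               (inj₂ fault)     = ⊥-elim (unrestricted-noFault W ⊥ₚ Γ fault)
unrestricted-static W dep ⊥ₚ Γ Δ (_ , same⊥ , _) lost (inj₁ (_ , won)) =
  lost (inj₁ ((λ _ → tt) , dep Δ Γ (≈r-sym same⊥) won))
unrestricted-static W dep ⊥ₚ Γ Δ _               lost (inj₂ fault) = unrestricted-noFault W ⊥ₚ Δ fault

bitSym : Bool → Sym
bitSym false = s0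
bitSym true  = s1

bitWord : List Bool → Move
bitWord = map bitSym

bitSym-injective : ∀ {b b′} → bitSym b ≡ bitSym b′ → b ≡ b′
bitSym-injective {false} {false} _ = refl
bitSym-injective {true}  {true}  _ = refl

bitWord-injective : ∀ {w w′} → bitWord w ≡ bitWord w′ → w ≡ w′
bitWord-injective = map-injective bitSym-injective

addr-bitWord : ∀ w α → addr (bitWord w ++ sdot ∷ α) ≡ just (w , α)
addr-bitWord []          α = refl
addr-bitWord (false ∷ w) α rewrite addr-bitWord w α = refl
addr-bitWord (true ∷ w)  α rewrite addr-bitWord w α = refl

-- The move 1.w.w : in the consequent, thread address w, payload w.
consequentMove : List Bool → Move
consequentMove w = s1 ∷ sdot ∷ (bitWord w ++ sdot ∷ bitWord w)

prefixOf-cong : ∀ w {x x′ : Bits} → x ≗ x′ → prefixOf w x ≡ prefixOf w x′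
prefixOf-cong []      x≗x′ = refl
prefixOf-cong (b ∷ w) x≗x′ = cong₂ _∧_ (cong (beq b) (x≗x′ 0)) (prefixOf-cong w (x≗x′ ∘ suc))

thr1-cong : ∀ {x x′ : Bits} → x ≗ x′ → thr1 x ≗ thr1 x′
thr1-cong x≗x′ (p , μ) with addr μ
... | just (w , α) rewrite prefixOf-cong w x≗x′ = refl
... | nothing      = refl

thread-cong : ∀ {x x′ : Bits} → x ≗ x′ → thread x ≗ thread x′
thread-cong x≗x′ = mapMaybe-cong (thr1-cong x≗x′)

AllBy : Player → Position → Set
AllBy p = All (λ m → proj₁ m ≡ p)

PreservesLabels : (LabMove → Maybe LabMove) → Set
PreservesLabels f = ∀ m {m′} → f m ≡ just m′ → proj₁ m′ ≡ proj₁ m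

mapMaybe-AllBy : ∀ {f p} → PreservesLabels f → ∀ {Φ} → AllBy p Φ → AllBy p (mapMaybe f Φ)
mapMaybe-AllBy         pres {[]}    []      = []
mapMaybe-AllBy {f} {p} pres {m ∷ Φ} (q ∷ qs) with f m in eq
... | just m′ = trans (pres m eq) q ∷ mapMaybe-AllBy pres qs
... | nothing = mapMaybe-AllBy pres qs

comp-preservesLabels : PreservesLabels (comp true)
comp-preservesLabels (_ , s1 ∷ sdot ∷ _) refl = refl
comp-preservesLabels (_ , [])            ()
comp-preservesLabels (_ , s0 ∷ _)        ()
comp-preservesLabels (_ , sdot ∷ _)      ()
comp-preservesLabels (_ , s1 ∷ [])       ()
comp-preservesLabels (_ , s1 ∷ s0 ∷ _)   ()
comp-preservesLabels (_ , s1 ∷ s1 ∷ _)   ()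

thr1-preservesLabels : ∀ x → PreservesLabels (thr1 x)
thr1-preservesLabels x (_ , μ) eq with addr μ
... | just (w , α) with prefixOf w x
thr1-preservesLabels x _ refl | just _ | true = refl

movesBy⊥-AllBy⊤ : ∀ {Φ} → AllBy ⊤ₚ Φ → movesBy ⊥ₚ Φ ≡ []
movesBy⊥-AllBy⊤ = filter-none _ ∘ All.map λ { refl () }

topMove-AllBy⊤ : ∀ M C → AllBy ⊤ₚ (topMove M C)
topMove-AllBy⊤ M C with eqFin (Config.state C) (HPM.moveState M)
... | true  = refl ∷ []
... | false = []

bitstrings : ℕ → List (List Bool)
bitstrings zero    = [ [] ]
bitstrings (suc n) = map (false ∷_) (bitstrings n) ++ map (true ∷_) (bitstrings n)

select : ∀ {A : Set} → Bits → (List Bool → A) → List Bool → Maybe A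
select y k w = if prefixOf w y then just (k w) else nothing

select-bitstrings : ∀ {A : Set} n y (k : List Bool → A) →
                    mapMaybe (select y k) (bitstrings n) ≡ [ k (applyUpTo y n) ]
select-bitstrings zero    y k = refl
select-bitstrings (suc n) y k = begin
    mapMaybe (select y k) (map (false ∷_) ws ++ map (true ∷_) ws)
  ≡⟨ mapMaybe-++ (select y k) (map (false ∷_) ws) (map (true ∷_) ws) ⟩
    mapMaybe (select y k) (map (false ∷_) ws) ++ mapMaybe (select y k) (map (true ∷_) ws)
  ≡⟨ cong₂ _++_ (mapMaybe-map (select y k) (false ∷_) ws) (mapMaybe-map (select y k) (true ∷_) ws) ⟩
    mapMaybe (selectAfter (y 0) false) ws ++ mapMaybe (selectAfter (y 0) true) ws
  ≡⟨ branch (y 0) ⟩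
    [ k (applyUpTo y (suc n)) ]
  ∎
  where
    open ≡-Reasoning
    ws = bitstrings n
    -- select y k (b ∷ w) unfolds to selectAfter (y 0) b w.
    selectAfter : Bool → Bool → List Bool → Maybe _
    selectAfter c b w = if beq b c ∧ prefixOf w (y ∘ suc) then just (k (b ∷ w)) else nothing
    branch : ∀ c → mapMaybe (selectAfter c false) ws ++ mapMaybe (selectAfter c true) ws
                   ≡ [ k (c ∷ applyUpTo (y ∘ suc) n) ]
    branch false = cong₂ _++_ (select-bitstrings n (y ∘ suc) (k ∘ (false ∷_))) (mapMaybe-nothing ws)
    branch true  = cong₂ _++_ (mapMaybe-nothing ws) (select-bitstrings n (y ∘ suc) (k ∘ (true ∷_)))

padded : List Bool → Bits
padded []      _       = false
padded (b ∷ w) zero    = b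
padded (b ∷ w) (suc i) = padded w i

padded-applyUpTo : ∀ N (x : Bits) → (∀ n → N ≤ n → x n ≡ false) → x ≗ padded (applyUpTo x N)
padded-applyUpTo zero    x zeros i       = zeros i z≤n
padded-applyUpTo (suc N) x zeros zero    = refl
padded-applyUpTo (suc N) x zeros (suc i) = padded-applyUpTo N (x ∘ suc) (λ n → zeros (suc n) ∘ s≤s) i

toℕᵇ : List Bool → ℕᵇ
toℕᵇ []          = ℕᵇ.zero
toℕᵇ (false ∷ w) = 2[1+ toℕᵇ w ]
toℕᵇ (true ∷ w)  = 1+[2 toℕᵇ w ]

fromℕᵇ : ℕᵇ → List Bool
fromℕᵇ ℕᵇ.zero   = []
fromℕᵇ 2[1+ n ] = false ∷ fromℕᵇ n
fromℕᵇ 1+[2 n ] = true ∷ fromℕᵇ n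

fromℕᵇ-toℕᵇ : ∀ w → fromℕᵇ (toℕᵇ w) ≡ w
fromℕᵇ-toℕᵇ []          = refl
fromℕᵇ-toℕᵇ (false ∷ w) = cong (false ∷_) (fromℕᵇ-toℕᵇ w)
fromℕᵇ-toℕᵇ (true ∷ w)  = cong (true ∷_) (fromℕᵇ-toℕᵇ w)

listCode : List Bool → ℕ
listCode = ℕᵇ.toℕ ∘ toℕᵇ

listCode-injective : ∀ {w w′} → listCode w ≡ listCode w′ → w ≡ w′
listCode-injective {w} {w′} eq = begin
  w                   ≡⟨ sym (fromℕᵇ-toℕᵇ w) ⟩
  fromℕᵇ (toℕᵇ w)     ≡⟨ cong fromℕᵇ (ℕᵇ.toℕ-injective eq) ⟩
  fromℕᵇ (toℕᵇ w′)    ≡⟨ fromℕᵇ-toℕᵇ w′ ⟩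
  w′                  ∎
  where open ≡-Reasoning

-- Constructive Cantor: deciding the fibres of f is what the diagonal needs.
Bits-not-injectable : (f : Bits → ℕ) → (∀ m → Dec (∃ λ y → f y ≡ m)) →
                      ¬ (∀ {y y′} → f y ≡ f y′ → y ≗ y′)
Bits-not-injectable f decide injective = diagonal (decide (f d)) refl
  where
    pick : ∀ {m} → Dec (∃ λ y → f y ≡ m) → Bits
    pick (yes (y , _)) = y
    pick (no _)        = const false
    d : Bits
    d m = not (pick (decide m) m)
    diagonal : (v : Dec (∃ λ y → f y ≡ f d)) → d (f d) ≡ not (pick v (f d)) → ⊥
    diagonal (no ∄y)          _   = ∄y (d , refl)
    diagonal (yes (y , fy≡fd)) eq = not-¬ (sym (injective fy≡fd (f d))) eq

applyUpTo-prefix⇒agree : ∀ {A : Set} (f g : ℕ → A) {n m} Θ →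
                         applyUpTo f n ++ Θ ≡ applyUpTo g m → ∀ {k} → k < n → f k ≡ g k
applyUpTo-prefix⇒agree f g {suc n} {zero}  Θ ()
applyUpTo-prefix⇒agree f g {suc n} {suc m} Θ eq {zero}  _         = ∷-injectiveˡ eq
applyUpTo-prefix⇒agree f g {suc n} {suc m} Θ eq {suc k} (s≤s k<n) =
  applyUpTo-prefix⇒agree (f ∘ suc) (g ∘ suc) Θ (∷-injectiveʳ eq) k<n

upto-singletons : ∀ (f : ℕ → LabMove) n → upto (λ t → [ f t ]) n ≡ applyUpTo f n
upto-singletons f zero    = refl
upto-singletons f (suc n) = trans (cong (_++ [ f n ]) (upto-singletons f n)) (applyUpTo-∷ʳ f n)

env : Env
env t = map consequentMove (bitstrings (suc t))

IsEnvMove : LabMove → Set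
IsEnvMove m = proj₁ m ≡ ⊥ₚ → ∃ λ w → proj₂ m ≡ consequentMove w

consequentMove-legal : ∀ C W Φ w → Lr (C ∨ᵍ Rec (unrestricted W)) Φ →
                       Lr (C ∨ᵍ Rec (unrestricted W)) (Φ ++ [ (⊥ₚ , consequentMove w) ])
consequentMove-legal C W Φ w (wellFormed , antecedent , parsable , _) =
    AllP.++⁺ wellFormed (tt ∷ [])
  , subst (Lr C) (sym (trans (mapMaybe-++ (comp false) Φ _) (++-identityʳ _))) antecedent
  , subst (recLr (unrestricted W)) (sym (mapMaybe-++ (comp true) Φ _))
          (AllP.++⁺ parsable (subst (T ∘ is-just) (sym (addr-bitWord w (bitWord w))) tt ∷ []) , λ _ → tt)

module Counterexample (M : HPM)
  (wins : ∀ (P : Game) → IsGame P → Static P → M ⊨ (Rec0 P ⇒ᵍ Rec P)) where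

  R : Run
  R = runOf M env

  upto-IsEnvMove : ∀ n → All IsEnvMove (upto R n)
  upto-IsEnvMove zero    = []
  upto-IsEnvMove (suc n) = AllP.++⁺ (upto-IsEnvMove n)
    (AllP.++⁺ (All.map (λ { refl () }) (topMove-AllBy⊤ M (config M env n))) (byEnv (bitstrings (suc n))))
    where
      byEnv : ∀ ws → All IsEnvMove (map (⊥ₚ ,_) (map consequentMove ws))
      byEnv []       = []
      byEnv (w ∷ ws) = (λ _ → w , refl) ∷ byEnv ws

  ⊥-never-faults : ∀ W → ¬ FaultBy ⊥ₚ (Rec0 (unrestricted W) ⇒ᵍ Rec (unrestricted W)) R
  ⊥-never-faults W (Φ , α , legal , illegal , n , Θ , eq)
    with AllP.++⁻ʳ Φ (AllP.++⁻ˡ (Φ ++ [ (⊥ₚ , α) ]) (subst (All IsEnvMove) (sym eq) (upto-IsEnvMove n)))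
  ... | isEnv ∷ [] with isEnv refl
  ...   | w , refl = illegal (consequentMove-legal (¬ᵍ (Rec0 (unrestricted W))) W Φ w legal)

  wins-unrestricted : ∀ W → DependsOnlyOn⊥ W → Win (Rec0 (unrestricted W) ⇒ᵍ Rec (unrestricted W)) R
  wins-unrestricted W dep with wins (unrestricted W) (unrestricted-isGame W dep) (unrestricted-static W dep) env
  ... | inj₁ (_ , won) = won
  ... | inj₂ fault     = ⊥-elim (⊥-never-faults W fault)

  -- With Win = const Z, the antecedent is won iff ¬ Z and the consequent iff Z.
  excluded-middle : (Z : Set) → Dec Z
  excluded-middle Z with wins-unrestricted (const Z) (λ _ _ _ z → z)
  ... | inj₁ ¬rec0 = no λ z → ¬rec0 λ _ _ → z
  ... | inj₂ rec   = yes (rec (const false))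

  antecedentThread : Bits → Run
  antecedentThread x = onlyBy ⊥ₚ (mapRun (thread x) (mapRun flipPos (mapRun (proj∨ false) R)))

  antecedentThread-cong : ∀ {x x′} → x ≗ x′ → antecedentThread x ≈r antecedentThread x′
  antecedentThread-cong x≗x′ = ≗⇒≈r (λ t → cong (movesBy ⊥ₚ) (thread-cong x≗x′ (flipPos (proj∨ false (R t)))))

  consequentThread : Bits → Run
  consequentThread y = onlyBy ⊥ₚ (mapRun (thread y) (mapRun (proj∨ true) R))

  consequentThreadMove : Bits → ℕ → LabMove
  consequentThreadMove y t = ⊥ₚ , bitWord (applyUpTo y (suc t))

  thread-upto-IsEnvMove : ∀ y ws → thread y (proj∨ true (map (⊥ₚ ,_) (map consequentMove ws)))
                             ≡ mapMaybe (select y (λ w → ⊥ₚ , bitWord w)) ws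
  thread-upto-IsEnvMove y []       = refl
  thread-upto-IsEnvMove y (w ∷ ws) rewrite addr-bitWord w (bitWord w) with prefixOf w y
  ... | true  = cong (_ ∷_) (thread-upto-IsEnvMove y ws)
  ... | false = thread-upto-IsEnvMove y ws

  consequentThread-chunk : ∀ y t → consequentThread y t ≡ [ consequentThreadMove y t ]
  consequentThread-chunk y t = begin
      movesBy ⊥ₚ (thread y (proj∨ true (tops ++ envs)))
    ≡⟨ cong (movesBy ⊥ₚ ∘ thread y) (mapMaybe-++ (comp true) tops envs) ⟩
      movesBy ⊥ₚ (thread y (proj∨ true tops ++ proj∨ true envs))
    ≡⟨ cong (movesBy ⊥ₚ) (mapMaybe-++ (thr1 y) (proj∨ true tops) (proj∨ true envs)) ⟩
      movesBy ⊥ₚ (thread y (proj∨ true tops) ++ thread y (proj∨ true envs))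
    ≡⟨ filter-++ _ (thread y (proj∨ true tops)) (thread y (proj∨ true envs)) ⟩
      movesBy ⊥ₚ (thread y (proj∨ true tops)) ++ movesBy ⊥ₚ (thread y (proj∨ true envs))
    ≡⟨ cong₂ _++_ (movesBy⊥-AllBy⊤ topInThread) (cong (movesBy ⊥ₚ) envInThread) ⟩
      [ consequentThreadMove y t ]
    ∎
    where
      open ≡-Reasoning
      tops = topMove M (config M env t)
      envs = map (⊥ₚ ,_) (env t)
      topInThread : AllBy ⊤ₚ (thread y (proj∨ true tops))
      topInThread = mapMaybe-AllBy (thr1-preservesLabels y)
                      (mapMaybe-AllBy comp-preservesLabels (topMove-AllBy⊤ M (config M env t)))
      envInThread : thread y (proj∨ true envs) ≡ [ consequentThreadMove y t ]
      envInThread = trans (thread-upto-IsEnvMove y (bitstrings (suc t)))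
                          (select-bitstrings (suc t) y (λ w → ⊥ₚ , bitWord w))

  consequentThread-upto : ∀ y n → upto (consequentThread y) n ≡ applyUpTo (consequentThreadMove y) n
  consequentThread-upto y n = trans (upto-cong (consequentThread-chunk y) n)
                                    (upto-singletons (consequentThreadMove y) n)

  -- ⊥'s k-th move in consequent thread y spells out y 0, …, y k.
  consequentThread-injective : ∀ {y y′} → consequentThread y ≈r consequentThread y′ → y ≗ y′
  consequentThread-injective {y} {y′} (y≲y′ , _) k with y≲y′ (suc k)
  ... | m , Θ , eq = applyUpTo-prefix⇒agree y y′ [] prefixes-agree ≤-refl
    where
      moves-agree : consequentThreadMove y k ≡ consequentThreadMove y′ k
      moves-agree = applyUpTo-prefix⇒agree (consequentThreadMove y) (consequentThreadMove y′) Θ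
        (subst₂ (λ Φ Ψ → Φ ++ Θ ≡ Ψ) (consequentThread-upto y (suc k)) (consequentThread-upto y′ m) eq) ≤-refl
      prefixes-agree : applyUpTo y (suc k) ++ [] ≡ applyUpTo y′ (suc k)
      prefixes-agree = trans (++-identityʳ _) (bitWord-injective (cong proj₂ moves-agree))

  MatchesFiniteThread : Run → Set
  MatchesFiniteThread r = ∃ λ w → onlyBy ⊥ₚ r ≈r antecedentThread (padded w)

  matchesFiniteThread-dependsOnlyOn⊥ : DependsOnlyOn⊥ MatchesFiniteThread
  matchesFiniteThread-dependsOnlyOn⊥ r r′ r≈r′ (w , matches) = w , ≈r-trans (≈r-sym r≈r′) matches

  P : Game
  P = unrestricted MatchesFiniteThread

  rec0-won : Win (Rec0 P) (mapRun flipPos (mapRun (proj∨ false) R))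
  rec0-won x (N , zeros) = applyUpTo x N , antecedentThread-cong (padded-applyUpTo N x zeros)

  rec-lost : ¬ Win (Rec P) (mapRun (proj∨ true) R)
  rec-lost won = Bits-not-injectable index (λ m → excluded-middle _) index-injective
    where
      index : Bits → ℕ
      index y = listCode (proj₁ (won y))
      index-injective : ∀ {y y′} → index y ≡ index y′ → y ≗ y′
      index-injective {y} {y′} eq = consequentThread-injective
        (≈r-trans (subst (λ w → consequentThread y ≈r antecedentThread (padded w)) (listCode-injective {proj₁ (won y)} {proj₁ (won y′)} eq) (proj₂ (won y)))
                  (≈r-sym (proj₂ (won y′))))

theorem5p1 : ¬ (Σ HPM λ M → ∀ (P : Game) → IsGame P → Static P → M ⊨ (Rec0 P ⇒ᵍ Rec P))
theorem5p1 (M , wins) =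
  [ (λ rec0-lost → rec0-lost rec0-won) , rec-lost ]′
    (wins-unrestricted MatchesFiniteThread matchesFiniteThread-dependsOnlyOn⊥)
  where open Counterexample M wins
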